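{- Let $W$ be a weighing matrix $W(23,16)$. Then the graph $\Gamma(W)$ has at least $138$ edges.
   Context: A weighing matrix $W(n,k)$ is an $n\times n$ matrix $W$ with entries in $\{0,1,-1\}$ whose rows are pairwise orthogonal and have length $\sqrt{k}$, i.e. $WW^T=kI_n$. For a weighing matrix $W$ of type $W(23,16)$ and $i\in\{1,\ldots,23\}$, let $L_i\subseteq\{1,\ldots,23\}$ (the $i$-th "line") be the set of column positions at which the $i$-th row of $W$ is zero. The graph $\Gamma(W)$ is the simple graph with vertex set $\{1,2,\ldots,23\}$ in which distinct $i$ and $j$ are joined by an edge if and only if $|L_i\cap L_j|=1$. -}

module Defs where

open import Algebra.Properties.CommutativeMonoid.Sum using (sum)
open import Data.Bool using (if_then_else_)
open import Data.Fin using (Fin)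
open import Data.Fin.Properties using (_≟_; _<?_)
open import Data.Fin.Subset using (Subset; _∩_; ∣_∣)
open import Data.Fin.Subset.Properties using (∩-comm)
open import Data.Integer using (ℤ; +_; _*_; 0ℤ; 1ℤ; -1ℤ)
import Data.Integer.Properties as ℤ
open import Data.List using (List; allFin; cartesianProduct; filter; length)
open import Data.Nat using (ℕ)
import Data.Nat.Properties as ℕ
open import Data.Product using (_×_; _,_; proj₁)
open import Data.Sum using (_⊎_)
open import Data.Vec using (tabulate)
open import Level using (0ℓ)
open import Relation.Binary using (Rel; Decidable; Symmetric; Irreflexive)
open import Relation.Binary.PropositionalEquality using (_≡_; _≢_; sym; trans; cong)
open import Relation.Nullary using (does; ¬?; _×-dec_)

Matrix : ℕ → Set
Matrix n = Fin n → Fin n → ℤ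

infixl 8 _ᵀ
infixl 7 _⊗_ _·_

_ᵀ : ∀ {n} → Matrix n → Matrix n
(A ᵀ) i j = A j i

_⊗_ : ∀ {n} → Matrix n → Matrix n → Matrix n
(A ⊗ B) i j = sum ℤ.+-0-commutativeMonoid (λ l → A i l * B l j)

I : ∀ {n} → Matrix n
I i j = if does (i ≟ j) then 1ℤ else 0ℤ

_·_ : ∀ {n} → ℤ → Matrix n → Matrix n
(c · A) i j = c * A i j

record IsWeighing {n : ℕ} (k : ℕ) (W : Matrix n) : Set where
  field
    entries    : ∀ i j → W i j ≡ 0ℤ ⊎ W i j ≡ 1ℤ ⊎ W i j ≡ -1ℤ
    orthogonal : ∀ i j → (W ⊗ W ᵀ) i j ≡ ((+ k) · I) i j

record SimpleGraph (n : ℕ) : Set₁ where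
  field
    Adj        : Rel (Fin n) 0ℓ
    adj?       : Decidable Adj
    adj-sym    : Symmetric Adj
    adj-irrefl : Irreflexive _≡_ Adj

-- Each unordered edge {i , j} is listed once, as the pair (i , j) with i < j.
edges : ∀ {n} → SimpleGraph n → List (Fin n × Fin n)
edges {n} G =
  filter (λ (i , j) → (i <? j) ×-dec adj? i j) (cartesianProduct (allFin n) (allFin n))
  where open SimpleGraph G

edgeCount : ∀ {n} → SimpleGraph n → ℕ
edgeCount G = length (edges G)

line : ∀ {n} → Matrix n → Fin n → Subset n
line W i = tabulate (λ j → does (W i j ℤ.≟ 0ℤ))

Γ : ∀ {n} → Matrix n → SimpleGraph n
Γ W = record
  { Adj        = λ i j → i ≢ j × ∣ line W i ∩ line W j ∣ ≡ 1
  ; adj?       = λ i j → ¬? (i ≟ j) ×-dec (∣ line W i ∩ line W j ∣ ℕ.≟ 1)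
  ; adj-sym    = λ {i} {j} (i≢j , e) →
      (λ j≡i → i≢j (sym j≡i)) , trans (cong ∣_∣ (∩-comm (line W j) (line W i))) e
  ; adj-irrefl = λ i≡j a → proj₁ a i≡j
  }

{-# OPTIONS --safe #-}

-- Over ℤ, W Wᵀ = k I forces Wᵀ W = k I, because ‖Wᵀ W − k I‖² = k (k n − tr (Wᵀ W)) = 0.  Hence for a
-- W(23,16) every column, like every row, has exactly 7 zeros, and ∑ⱼ |Lᵢ ∩ Lⱼ| = 7 · 7 = 49 for each i,
-- of which j = i contributes 7.  Orthogonality of rows i ≠ j makes the number of common nonzero positions,
-- 9 + |Lᵢ ∩ Lⱼ|, even, so the 22 remaining intersections are odd and sum to 42.  At most 10 of them are
-- at least 3, so every vertex of Γ(W) has degree at least 12, and 23 · 12 / 2 = 138.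
module Submission where

open import Algebra.Bundles using (AbelianGroup)
import Algebra.Properties.Group as Group
import Algebra.Properties.Semiring.Sum as Sum
open import Data.Bool using (Bool; true; false; if_then_else_; _∧_)
open import Data.Bool.Properties using (∧-zeroʳ)
open import Data.Fin using (Fin; zero; suc)
import Data.Fin as Fin
open import Data.Fin.Properties using (_≟_; _<?_; <-cmp)
open import Data.Fin.Subset using (_∩_; ∣_∣)
open import Data.Integer using (ℤ; +_; -[1+_]; _+_; _*_; _-_; _≤_; +≤+; -_; 0ℤ; 1ℤ; -1ℤ)
open import Data.Integer.Divisibility.Signed
  using (_∣_; divides; _∣?_; ∣m∣n⇒∣m+n)
open import Data.Integer.Properties as ℤ
  using (+-*-semiring; +-mono-≤; ≤-refl; *-comm; *-assoc)
open import Data.Integer.Tactic.RingSolver using (solve-∀)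
open import Data.List using (cartesianProduct; filter; length; map; _++_)
import Data.List as List
open import Data.List.Properties using (map-tabulate; length-++; filter-++)
open import Data.Nat using (zero; suc; z≤n; s≤s; _≥_)
import Data.Nat as ℕ
open import Data.Product using (_×_; _,_; proj₁; proj₂)
open import Data.Sum using (_⊎_; inj₁; inj₂; [_,_]′)
open import Data.Vec using (tabulate)
open import Defs
open import Function using (_∘_; id; mk⇔)
open import Relation.Binary using (tri<; tri≈; tri>)
open import Relation.Binary.PropositionalEquality
  using (_≡_; _≢_; refl; sym; trans; cong; cong₂; subst; subst₂; module ≡-Reasoning)
open import Relation.Nullary using (¬_; does; yes; no; _×-dec_; contradiction)
open import Relation.Nullary.Decidable using (dec-true; dec-false; does-⇔; from-no)
open import Relation.Unary using (Pred; Decidable)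

open Sum +-*-semiring
  using (sum; sum-cong-≗; ∑-distrib-+; ∑-comm; *-distribˡ-sum; *-distribʳ-sum; sum-syntax; sum-replicate-zero)
open Group (AbelianGroup.group ℤ.+-0-abelianGroup) using (∙-cancelʳ; \\-leftDividesʳ)

-- Order and squares in the integers.

+-cancelˡ-≤ : ∀ i {j k} → i + j ≤ i + k → j ≤ k
+-cancelˡ-≤ i {j} {k} i+j≤i+k =
  subst₂ _≤_ (\\-leftDividesʳ i j) (\\-leftDividesʳ i k) (ℤ.+-monoʳ-≤ (- i) i+j≤i+k)

0≤i*i : ∀ i → 0ℤ ≤ i * i
0≤i*i (+ zero)  = +≤+ z≤n
0≤i*i (+ suc n) = +≤+ z≤n
0≤i*i -[1+ n ]  = +≤+ z≤n

i*i≡0⇒i≡0 : ∀ i → i * i ≡ 0ℤ → i ≡ 0ℤ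
i*i≡0⇒i≡0 i eq = [ id , id ]′ (ℤ.i*j≡0⇒i≡0∨j≡0 i eq)

-- Sums over Fin n

sum-mono-≤ : ∀ {n} {f g : Fin n → ℤ} → (∀ i → f i ≤ g i) → sum f ≤ sum g
sum-mono-≤ {zero}  f≤g = ≤-refl
sum-mono-≤ {suc n} f≤g = +-mono-≤ (f≤g zero) (sum-mono-≤ (f≤g ∘ suc))

sum-nonNeg : ∀ {n} {f : Fin n → ℤ} → (∀ i → 0ℤ ≤ f i) → 0ℤ ≤ sum f
sum-nonNeg {zero}  0≤f = ≤-refl
sum-nonNeg {suc n} 0≤f = +-mono-≤ (0≤f zero) (sum-nonNeg (0≤f ∘ suc))

nonNeg+nonNeg≡0⇒≡0 : ∀ {i j} → 0ℤ ≤ i → 0ℤ ≤ j → i + j ≡ 0ℤ → i ≡ 0ℤ × j ≡ 0ℤ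
nonNeg+nonNeg≡0⇒≡0 {+ zero}  {+ zero}  _ _ _  = refl , refl
nonNeg+nonNeg≡0⇒≡0 {+ zero}  {+ suc n} _ _ ()
nonNeg+nonNeg≡0⇒≡0 {+ suc m} {+ n}     _ _ ()

sum≡0⇒≡0 : ∀ {n} {f : Fin n → ℤ} → (∀ i → 0ℤ ≤ f i) → sum f ≡ 0ℤ → ∀ i → f i ≡ 0ℤ
sum≡0⇒≡0 0≤f eq zero    = proj₁ (nonNeg+nonNeg≡0⇒≡0 (0≤f zero) (sum-nonNeg (0≤f ∘ suc)) eq)
sum≡0⇒≡0 0≤f eq (suc i) =
  sum≡0⇒≡0 (0≤f ∘ suc) (proj₂ (nonNeg+nonNeg≡0⇒≡0 (0≤f zero) (sum-nonNeg (0≤f ∘ suc)) eq)) i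

∣-sum : ∀ {n} {k} {f : Fin n → ℤ} → (∀ i → k ∣ f i) → k ∣ sum f
∣-sum {zero}  k∣f = divides 0ℤ refl
∣-sum {suc n} k∣f = ∣m∣n⇒∣m+n (k∣f zero) (∣-sum (k∣f ∘ suc))

-- Entries of the identity matrix.

I-diagonal : ∀ {n} (i : Fin n) → I i i ≡ 1ℤ
I-diagonal i = cong (if_then 1ℤ else 0ℤ) (dec-true (i ≟ i) refl)

I-offDiagonal : ∀ {n} {i j : Fin n} → i ≢ j → I i j ≡ 0ℤ
I-offDiagonal {i = i} {j} i≢j = cong (if_then 1ℤ else 0ℤ) (dec-false (i ≟ j) i≢j)

sum-I : ∀ {n} (f : Fin n → ℤ) i → ∑[ j < n ] (f j * I i j) ≡ f i
sum-I {suc n} f zero = begin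
  f zero * 1ℤ + ∑[ j < n ] (f (suc j) * 0ℤ)  ≡⟨ cong₂ _+_ (ℤ.*-identityʳ (f zero)) (sum-cong-≗ (ℤ.*-zeroʳ ∘ f ∘ suc)) ⟩
  f zero + ∑[ j < n ] 0ℤ                    ≡⟨ cong (_+_ (f zero)) (sum-replicate-zero n) ⟩
  f zero + 0ℤ                               ≡⟨ ℤ.+-identityʳ (f zero) ⟩
  f zero                                    ∎
  where open ≡-Reasoning
sum-I {suc n} f (suc i) = begin
  f zero * 0ℤ + ∑[ j < n ] (f (suc j) * I i j)  ≡⟨ cong₂ _+_ (ℤ.*-zeroʳ (f zero)) (sum-I (f ∘ suc) i) ⟩
  0ℤ + f (suc i)                                ≡⟨ ℤ.+-identityˡ (f (suc i)) ⟩
  f (suc i)                                     ∎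
  where open ≡-Reasoning

-- W Wᵀ = k I implies Wᵀ W = k I

⊗-assoc : ∀ {n} (A B C : Matrix n) i j → ((A ⊗ B) ⊗ C) i j ≡ (A ⊗ (B ⊗ C)) i j
⊗-assoc {n} A B C i j = begin
  ∑[ l < n ] (∑[ m < n ] (A i m * B m l) * C l j)
    ≡⟨ sum-cong-≗ (λ l → *-distribʳ-sum (C l j) (λ m → A i m * B m l)) ⟩
  ∑[ l < n ] ∑[ m < n ] (A i m * B m l * C l j)
    ≡⟨ ∑-comm (λ l m → A i m * B m l * C l j) ⟩
  ∑[ m < n ] ∑[ l < n ] (A i m * B m l * C l j)
    ≡⟨ sum-cong-≗ (λ m → sum-cong-≗ (λ l → *-assoc (A i m) (B m l) (C l j))) ⟩
  ∑[ m < n ] ∑[ l < n ] (A i m * (B m l * C l j))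
    ≡⟨ sum-cong-≗ (λ m → sym (*-distribˡ-sum (A i m) (λ l → B m l * C l j))) ⟩
  ∑[ m < n ] (A i m * ∑[ l < n ] (B m l * C l j))
    ∎
  where open ≡-Reasoning

·I⊗ : ∀ {n} k (A : Matrix n) i j → ((k · I) ⊗ A) i j ≡ k * A i j
·I⊗ {n} k A i j = begin
  ∑[ l < n ] (k * I i l * A l j)    ≡⟨ sum-cong-≗ (λ l → swap k (I i l) (A l j)) ⟩
  ∑[ l < n ] (k * A l j * I i l)    ≡⟨ sum-I (λ l → k * A l j) i ⟩
  k * A i j                         ∎
  where
  open ≡-Reasoning
  swap : ∀ a b c → a * b * c ≡ a * c * b
  swap = solve-∀

module _ {n} (k : ℤ) (W : Matrix n) (orth : ∀ i j → (W ⊗ W ᵀ) i j ≡ (k · I) i j) where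

  private
    A D : Matrix n
    A = W ᵀ ⊗ W
    D i j = A i j - k * I i j

    open ≡-Reasoning

    W⊗A : ∀ i j → (W ⊗ A) i j ≡ k * W i j
    W⊗A i j = begin
      (W ⊗ (W ᵀ ⊗ W)) i j    ≡⟨ ⊗-assoc W (W ᵀ) W i j ⟨
      ((W ⊗ W ᵀ) ⊗ W) i j    ≡⟨ sum-cong-≗ (λ l → cong (_* W l j) (orth i l)) ⟩
      ((k · I) ⊗ W) i j      ≡⟨ ·I⊗ k W i j ⟩
      k * W i j              ∎

    -- Up to the factor `k`, `A` is a projection: the middle product `W ⊗ W ᵀ` inside `A ⊗ A`
    -- collapses to `k · I`.
    A⊗A : ∀ i j → (A ⊗ A) i j ≡ k * A i j
    A⊗A i j = begin
      ((W ᵀ ⊗ W) ⊗ A) i j                  ≡⟨ ⊗-assoc (W ᵀ) W A i j ⟩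
      (W ᵀ ⊗ (W ⊗ A)) i j                  ≡⟨ sum-cong-≗ (λ l → cong (W l i *_) (W⊗A l j)) ⟩
      ∑[ l < n ] (W l i * (k * W l j))     ≡⟨ sum-cong-≗ (λ l → swap (W l i) k (W l j)) ⟩
      ∑[ l < n ] (k * (W l i * W l j))     ≡⟨ *-distribˡ-sum k (λ l → W l i * W l j) ⟨
      k * A i j                            ∎
      where
      swap : ∀ a b c → a * (b * c) ≡ b * (a * c)
      swap = solve-∀

    A-sym : ∀ i j → A i j ≡ A j i
    A-sym i j = sum-cong-≗ (λ l → *-comm (W l i) (W l j))

    -- Both sides are the sum of the squares of all entries of `W`, taken by columns on the left and
    -- by rows on the right.
    trace : ∑[ i < n ] A i i ≡ ∑[ i < n ] (k * I i i)
    trace = begin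
      ∑[ i < n ] ∑[ l < n ] (W l i * W l i)   ≡⟨ ∑-comm (λ i l → W l i * W l i) ⟩
      ∑[ l < n ] ∑[ i < n ] (W l i * W l i)   ≡⟨ sum-cong-≗ (λ l → orth l l) ⟩
      ∑[ l < n ] (k * I l l)                  ∎

    -- As `A` is symmetric, the squares `A i j * A i j` sum to a diagonal entry of A² = kA. Hence D²
    -- = A² - 2kA + k²I = k²I - kA on the diagonal; moving `k * A i i` to the left keeps both sides
    -- free of differences.
    rowNorm : ∀ i → ∑[ j < n ] (D i j * D i j) + k * A i i ≡ k * (k * I i i)
    rowNorm i = begin
      ∑[ j < n ] (D i j * D i j) + k * A i i
        ≡⟨ cong (λ x → x + k * A i i) (sum-cong-≗ (λ j → trans (square (A i j) k (I i j)) (cong (λ a → A i j * a + F j * I i j) (A-sym i j)))) ⟩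
      ∑[ j < n ] (A i j * A j i + F j * I i j) + k * A i i
        ≡⟨ cong (λ x → x + k * A i i) (∑-distrib-+ (λ j → A i j * A j i) (λ j → F j * I i j)) ⟩
      (A ⊗ A) i i + ∑[ j < n ] (F j * I i j) + k * A i i
        ≡⟨ cong₂ (λ x y → x + y + k * A i i) (A⊗A i i) (sum-I F i) ⟩
      k * A i i + F i + k * A i i
        ≡⟨ collect k (A i i) (I i i) ⟩
      k * (k * I i i)
        ∎
      where
      -- The remaining terms of the expanded square share the factor `I i j`, so `sum-I` evaluates
      -- their sum at `j = i`.
      F : Fin n → ℤ
      F j = k * (k * I i j) - (k * A i j + k * A i j)
      square : ∀ a k d → (a - k * d) * (a - k * d) ≡ a * a + (k * (k * d) - (k * a + k * a)) * d
      square = solve-∀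
      collect : ∀ k a d → k * a + (k * (k * d) - (k * a + k * a)) + k * a ≡ k * (k * d)
      collect = solve-∀

    norm : ∑[ i < n ] ∑[ j < n ] (D i j * D i j) ≡ 0ℤ
    -- Summed over `i`, `rowNorm` reads ‖D‖² + k tr A = k tr(kI); by `trace` the right side is k tr
    -- A, which cancels.
    norm = ∙-cancelʳ (k * ∑[ i < n ] A i i) _ _ (begin
      ∑[ i < n ] ∑[ j < n ] (D i j * D i j) + k * ∑[ i < n ] A i i
        ≡⟨ cong (_+_ (∑[ i < n ] ∑[ j < n ] (D i j * D i j))) (*-distribˡ-sum {n} k (λ i → A i i)) ⟩
      ∑[ i < n ] ∑[ j < n ] (D i j * D i j) + ∑[ i < n ] (k * A i i)
        ≡⟨ ∑-distrib-+ (λ i → ∑[ j < n ] (D i j * D i j)) (λ i → k * A i i) ⟨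
      ∑[ i < n ] (∑[ j < n ] (D i j * D i j) + k * A i i)
        ≡⟨ sum-cong-≗ rowNorm ⟩
      ∑[ i < n ] (k * (k * I i i))
        ≡⟨ *-distribˡ-sum {n} k (λ i → k * I i i) ⟨
      k * ∑[ i < n ] (k * I i i)
        ≡⟨ cong (k *_) trace ⟨
      k * ∑[ i < n ] A i i
        ≡⟨ ℤ.+-identityˡ _ ⟨
      0ℤ + k * ∑[ i < n ] A i i
        ∎)

  transpose-orthogonal : ∀ i j → (W ᵀ ⊗ W) i j ≡ (k · I) i j
  transpose-orthogonal i j = ℤ.i-j≡0⇒i≡j _ _ (i*i≡0⇒i≡0 (D i j)
    -- A vanishing sum of squares is split twice: from the total to a single row, then from that row
    -- to a single entry.
    (sum≡0⇒≡0 (λ j → 0≤i*i (D i j)) (sum≡0⇒≡0 (λ i → sum-nonNeg (λ j → 0≤i*i (D i j))) norm i) j))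

-- Counting with indicators

𝟙 : Bool → ℤ
𝟙 b = if b then 1ℤ else 0ℤ

0≤𝟙 : ∀ b → 0ℤ ≤ 𝟙 b
0≤𝟙 true  = +≤+ z≤n
0≤𝟙 false = +≤+ z≤n

∣tabulate∩tabulate∣ : ∀ {n} (f g : Fin n → Bool) →
                      + ∣ tabulate f ∩ tabulate g ∣ ≡ ∑[ l < n ] (𝟙 (f l) * 𝟙 (g l))
∣tabulate∩tabulate∣ {zero}  f g = refl
∣tabulate∩tabulate∣ {suc n} f g with f zero | g zero
... | true  | true  = cong (_+_ 1ℤ) (∣tabulate∩tabulate∣ (f ∘ suc) (g ∘ suc))
... | true  | false = trans (∣tabulate∩tabulate∣ (f ∘ suc) (g ∘ suc)) (sym (ℤ.+-identityˡ _))
... | false | _     = trans (∣tabulate∩tabulate∣ (f ∘ suc) (g ∘ suc)) (sym (ℤ.+-identityˡ _))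

-- A general `f` is needed for the induction, since the tail of `tabulate f` is
-- `tabulate (f ∘ suc)`; `allFin` is the case `f = id`.
length-filter-tabulate : ∀ {a p n} {A : Set a} {P : Pred A p} (P? : Decidable P) (f : Fin n → A) →
                         + length (filter P? (List.tabulate f)) ≡ ∑[ i < n ] 𝟙 (does (P? (f i)))
length-filter-tabulate {n = zero}  P? f = refl
length-filter-tabulate {n = suc n} P? f with does (P? (f zero))
... | true  = cong (_+_ 1ℤ) (length-filter-tabulate P? (f ∘ suc))
... | false = trans (length-filter-tabulate P? (f ∘ suc)) (sym (ℤ.+-identityˡ _))

length-filter-cartesianProduct :
  ∀ {a b p m n} {A : Set a} {B : Set b} {P : Pred (A × B) p} (P? : Decidable P) (f : Fin m → A) (g : Fin n → B) →
  + length (filter P? (cartesianProduct (List.tabulate f) (List.tabulate g)))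
    ≡ ∑[ i < m ] ∑[ j < n ] 𝟙 (does (P? (f i , g j)))
length-filter-cartesianProduct {m = zero}          P? f g = refl
length-filter-cartesianProduct {m = suc m} {n = n} P? f g = begin
  + length (filter P? (firstRow ++ otherRows))
    ≡⟨ cong (+_ ∘ length) (filter-++ P? firstRow otherRows) ⟩
  + length (filter P? firstRow ++ filter P? otherRows)
    ≡⟨ cong +_ (length-++ (filter P? firstRow)) ⟩
  + length (filter P? firstRow) + + length (filter P? otherRows)
    ≡⟨ cong₂ _+_
         (trans (cong (+_ ∘ length ∘ filter P?) (map-tabulate g (f zero ,_)))
                (length-filter-tabulate P? (λ j → f zero , g j)))
         (length-filter-cartesianProduct P? (f ∘ suc) g) ⟩
  ∑[ i < suc m ] ∑[ j < n ] 𝟙 (does (P? (f i , g j)))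
    ∎
  where
  open ≡-Reasoning
  firstRow  = map (f zero ,_) (List.tabulate g)
  otherRows = cartesianProduct (List.tabulate (f ∘ suc)) (List.tabulate g)

-- Degrees and the edge count of a graph.

module _ {n} (G : SimpleGraph n) where
  open SimpleGraph G

  degree : Fin n → ℤ
  degree i = ∑[ j < n ] 𝟙 (does (adj? i j))

  -- An adjacent pair is increasing in exactly one of its two orders, and exchanging the summations
  -- turns the decreasing half into a second copy of the edge count.
  handshake : ∑[ i < n ] degree i ≡ + 2 * + edgeCount G
  handshake = begin
    ∑[ i < n ] ∑[ j < n ] 𝟙 (does (adj? i j))
      ≡⟨ sum-cong-≗ (λ i → sum-cong-≗ (split i)) ⟩
    ∑[ i < n ] ∑[ j < n ] (e i j + e j i)
      ≡⟨ sum-cong-≗ (λ i → ∑-distrib-+ (e i) (λ j → e j i)) ⟩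
    ∑[ i < n ] (∑[ j < n ] e i j + ∑[ j < n ] e j i)
      ≡⟨ ∑-distrib-+ (λ i → ∑[ j < n ] e i j) (λ i → ∑[ j < n ] e j i) ⟩
    ∑[ i < n ] ∑[ j < n ] e i j + ∑[ i < n ] ∑[ j < n ] e j i
      ≡⟨ cong (_+_ (∑[ i < n ] ∑[ j < n ] e i j)) (∑-comm (λ i j → e j i)) ⟩
    ∑[ i < n ] ∑[ j < n ] e i j + ∑[ i < n ] ∑[ j < n ] e i j
      ≡⟨ cong₂ _+_ count count ⟨
    + edgeCount G + + edgeCount G
      ≡⟨ double (+ edgeCount G) ⟩
    + 2 * + edgeCount G
      ∎
    where
    open ≡-Reasoning
    e : Fin n → Fin n → ℤ
    e i j = 𝟙 (does (i <? j) ∧ does (adj? i j))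
    count : + edgeCount G ≡ ∑[ i < n ] ∑[ j < n ] e i j
    count = length-filter-cartesianProduct (λ (i , j) → (i <? j) ×-dec adj? i j) id id
    double : ∀ x → x + x ≡ + 2 * x
    double = solve-∀
    e-nonadj : ∀ i j → does (adj? i j) ≡ false → e i j ≡ 0ℤ
    e-nonadj i j eq = cong 𝟙 (trans (cong (does (i <? j) ∧_) eq) (∧-zeroʳ _))
    e-< : ∀ i j → i Fin.< j → e i j ≡ 𝟙 (does (adj? i j))
    e-< i j i<j = cong (λ b → 𝟙 (b ∧ does (adj? i j))) (dec-true (i <? j) i<j)
    e-≮ : ∀ i j → ¬ i Fin.< j → e i j ≡ 0ℤ
    e-≮ i j i≮j = cong (λ b → 𝟙 (b ∧ does (adj? i j))) (dec-false (i <? j) i≮j)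
    adj-comm : ∀ i j → does (adj? i j) ≡ does (adj? j i)
    adj-comm i j = does-⇔ (mk⇔ adj-sym adj-sym) (adj? i j) (adj? j i)
    split : ∀ i j → 𝟙 (does (adj? i j)) ≡ e i j + e j i
    split i j with <-cmp i j
    ... | tri< i<j _ j≮i = sym (trans (cong₂ _+_ (e-< i j i<j) (e-≮ j i j≮i)) (ℤ.+-identityʳ _))
    ... | tri> i≮j _ j<i = sym (trans (cong₂ _+_ (e-≮ i j i≮j) (e-< j i j<i))
                                 (trans (ℤ.+-identityˡ _) (cong 𝟙 (adj-comm j i))))
    -- On the diagonal neither order is strict, and irreflexivity makes the left side zero as well.
    ... | tri≈ i≮j i≡j j≮i = trans (cong 𝟙 (dec-false (adj? i j) (adj-irrefl i≡j)))
                                   (sym (cong₂ _+_ (e-≮ i j i≮j) (e-≮ j i j≮i)))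

-- Weighing matrices W(23,16)

Trit : ℤ → Set
Trit x = x ≡ 0ℤ ⊎ x ≡ 1ℤ ⊎ x ≡ -1ℤ

-- On 0, 1 and -1 the square is the indicator of being nonzero, so zeros can be counted through row
-- and column norms.
zeroIndicator+square≡1 : ∀ {x} → Trit x → 𝟙 (does (x ℤ.≟ 0ℤ)) + x * x ≡ 1ℤ
zeroIndicator+square≡1 (inj₁ refl)        = refl
zeroIndicator+square≡1 (inj₂ (inj₁ refl)) = refl
zeroIndicator+square≡1 (inj₂ (inj₂ refl)) = refl

2∣square-self : ∀ {x} → Trit x → + 2 ∣ x * x - x
2∣square-self (inj₁ refl)        = divides 0ℤ refl
2∣square-self (inj₂ (inj₁ refl)) = divides 0ℤ refl
2∣square-self (inj₂ (inj₂ refl)) = divides 1ℤ refl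

Trit-* : ∀ {x y} → Trit x → Trit y → Trit (x * y)
Trit-* (inj₁ refl)        _                  = inj₁ refl
Trit-* (inj₂ (inj₁ refl)) (inj₁ refl)        = inj₁ refl
Trit-* (inj₂ (inj₁ refl)) (inj₂ (inj₁ refl)) = inj₂ (inj₁ refl)
Trit-* (inj₂ (inj₁ refl)) (inj₂ (inj₂ refl)) = inj₂ (inj₂ refl)
Trit-* (inj₂ (inj₂ refl)) (inj₁ refl)        = inj₁ refl
Trit-* (inj₂ (inj₂ refl)) (inj₂ (inj₁ refl)) = inj₂ (inj₂ refl)
Trit-* (inj₂ (inj₂ refl)) (inj₂ (inj₂ refl)) = inj₂ (inj₁ refl)

-- The divisibility makes `m` odd. The only odd number below 3 is 1, and there the correction
-- supplies the missing 2.
3≤odd+2[odd≡1] : ∀ m → + 2 ∣ + m + + 9 → + 3 ≤ + m + + 2 * 𝟙 (does (m ℕ.≟ 1))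
3≤odd+2[odd≡1] 0 2∣9  = contradiction 2∣9 (from-no (+ 2 ∣? + 9))
3≤odd+2[odd≡1] 1 _    = ≤-refl
3≤odd+2[odd≡1] 2 2∣11 = contradiction 2∣11 (from-no (+ 2 ∣? + 11))
3≤odd+2[odd≡1] (suc (suc (suc m))) _ = +≤+ (s≤s (s≤s (s≤s z≤n)))

module _ (W : Matrix 23) (isWeighing : IsWeighing 16 W) where
  open IsWeighing isWeighing
  open SimpleGraph (Γ W)

  private
    Z : Matrix 23
    Z i j = 𝟙 (does (W i j ℤ.≟ 0ℤ))

    M : Matrix 23
    M i j = + ∣ line W i ∩ line W j ∣

    Z+W²≡1 : ∀ i j → Z i j + W i j * W i j ≡ 1ℤ
    Z+W²≡1 i j = zeroIndicator+square≡1 (entries i j)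

    M≡∑ZZ : ∀ i j → M i j ≡ ∑[ l < 23 ] (Z i l * Z j l)
    M≡∑ZZ i j = ∣tabulate∩tabulate∣ (λ l → does (W i l ℤ.≟ 0ℤ)) (λ l → does (W j l ℤ.≟ 0ℤ))

    rowSquares : ∀ i → ∑[ j < 23 ] (W i j * W i j) ≡ + 16
    rowSquares i = trans (orthogonal i i) (cong (+ 16 *_) (I-diagonal i))

    columnSquares : ∀ j → ∑[ i < 23 ] (W i j * W i j) ≡ + 16
    columnSquares j = trans (transpose-orthogonal (+ 16) W orthogonal j j) (cong (+ 16 *_) (I-diagonal j))

    zeros≡7 : (z w : Fin 23 → ℤ) → (∀ i → z i + w i ≡ 1ℤ) → sum w ≡ + 16 → sum z ≡ + 7
    zeros≡7 z w z+w≡1 ∑w≡16 = ∙-cancelʳ (+ 16) _ _ (begin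
      sum z + + 16             ≡⟨ cong (_+_ (sum z)) ∑w≡16 ⟨
      sum z + sum w            ≡⟨ ∑-distrib-+ z w ⟨
      ∑[ i < 23 ] (z i + w i)  ≡⟨ sum-cong-≗ z+w≡1 ⟩
      -- The sum of 23 ones evaluates to 23 = 7 + 16.
      + 7 + + 16               ∎)
      where
      open ≡-Reasoning

    rowZeros : ∀ i → ∑[ j < 23 ] Z i j ≡ + 7
    rowZeros i = zeros≡7 (Z i) _ (Z+W²≡1 i) (rowSquares i)

    columnZeros : ∀ j → ∑[ i < 23 ] Z i j ≡ + 7
    columnZeros j = zeros≡7 (λ i → Z i j) _ (λ i → Z+W²≡1 i j) (columnSquares j)

    -- Double counting: each of the 7 zeros of row `i` lies in a column that contains 7 zeros.
    ∑M≡49 : ∀ i → ∑[ j < 23 ] M i j ≡ + 49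
    ∑M≡49 i = begin
      ∑[ j < 23 ] M i j                          ≡⟨ sum-cong-≗ (M≡∑ZZ i) ⟩
      ∑[ j < 23 ] ∑[ l < 23 ] (Z i l * Z j l)    ≡⟨ ∑-comm (λ j l → Z i l * Z j l) ⟩
      ∑[ l < 23 ] ∑[ j < 23 ] (Z i l * Z j l)    ≡⟨ sum-cong-≗ (λ l → sym (*-distribˡ-sum (Z i l) (λ j → Z j l))) ⟩
      ∑[ l < 23 ] (Z i l * ∑[ j < 23 ] Z j l)    ≡⟨ sum-cong-≗ (λ l → cong (Z i l *_) (columnZeros l)) ⟩
      ∑[ l < 23 ] (Z i l * + 7)                  ≡⟨ *-distribʳ-sum (+ 7) (Z i) ⟨
      ∑[ l < 23 ] Z i l * + 7                    ≡⟨ cong (_* + 7) (rowZeros i) ⟩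
      + 49                                       ∎
      where open ≡-Reasoning

    M-diagonal : ∀ i → M i i ≡ + 7
    M-diagonal i = trans (M≡∑ZZ i i) (trans (sum-cong-≗ (λ l → 𝟙-idem (does (W i l ℤ.≟ 0ℤ)))) (rowZeros i))
      where
      𝟙-idem : ∀ b → 𝟙 b * 𝟙 b ≡ 𝟙 b
      𝟙-idem true  = refl
      𝟙-idem false = refl

    -- |Lᵢ ∩ Lⱼ| + 9 counts the common nonzero positions, as ∑ₗ v² with v = Wᵢₗ Wⱼₗ, and v² ≡ v modulo 2.
    2∣M+9 : ∀ {i j} → i ≢ j → + 2 ∣ M i j + + 9
    2∣M+9 {i} {j} i≢j = subst (+ 2 ∣_) (sym M+9≡∑) (∣-sum (λ l → 2∣square-self (Trit-* (entries i l) (entries j l))))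
      where
      open ≡-Reasoning
      v d : Fin 23 → ℤ
      v l = W i l * W j l
      d l = v l * v l - v l

      -- Inclusion-exclusion with x = 1 - p² and y = 1 - q². The term p²q² is written as (p²q² - pq)
      -- + pq to separate an even part from one that sums to zero by orthogonality. The hypotheses
      -- enter as factors of a ring identity.
      expand : ∀ x y p q → x + p * p ≡ 1ℤ → y + q * q ≡ 1ℤ →
               x * y + (p * p + q * q) ≡ 1ℤ + ((p * q) * (p * q) - p * q + p * q)
      expand x y p q x+p²≡1 y+q²≡1 = begin
        x * y + (p * p + q * q)
          ≡⟨ identity x y p q ⟩
        (x + p * p) * (y + q * q) + (1ℤ - (x + p * p)) * (q * q) + (1ℤ - (y + q * q)) * (p * p) + r
          ≡⟨ cong₂ (λ s t → s * t + (1ℤ - s) * (q * q) + (1ℤ - t) * (p * p) + r) x+p²≡1 y+q²≡1 ⟩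
        1ℤ + 0ℤ + 0ℤ + r
          ∎
        where
        r = (p * q) * (p * q) - p * q + p * q
        identity : ∀ x y p q → x * y + (p * p + q * q) ≡
          (x + p * p) * (y + q * q) + (1ℤ - (x + p * p)) * (q * q) + (1ℤ - (y + q * q)) * (p * p)
          + ((p * q) * (p * q) - p * q + p * q)
        identity = solve-∀

      M+9≡∑ : M i j + + 9 ≡ sum d
      -- Here 9 = 16 + 16 - 23: two row norms minus the number of columns. Adding 23 to both sides
      -- avoids the subtraction.
      M+9≡∑ = ∙-cancelʳ (+ 23) _ _ (begin
        M i j + + 9 + + 23
          ≡⟨ ℤ.+-assoc (M i j) (+ 9) (+ 23) ⟩
        M i j + (+ 16 + + 16)
          ≡⟨ cong₂ _+_ (M≡∑ZZ i j)
               (sym (trans (∑-distrib-+ (λ l → W i l * W i l) (λ l → W j l * W j l))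
                           (cong₂ _+_ (rowSquares i) (rowSquares j)))) ⟩
        ∑[ l < 23 ] (Z i l * Z j l) + ∑[ l < 23 ] (W i l * W i l + W j l * W j l)
          ≡⟨ ∑-distrib-+ (λ l → Z i l * Z j l) (λ l → W i l * W i l + W j l * W j l) ⟨
        ∑[ l < 23 ] (Z i l * Z j l + (W i l * W i l + W j l * W j l))
          ≡⟨ sum-cong-≗ (λ l → expand (Z i l) (Z j l) (W i l) (W j l) (Z+W²≡1 i l) (Z+W²≡1 j l)) ⟩
        ∑[ l < 23 ] (1ℤ + (d l + v l))
          ≡⟨ ∑-distrib-+ {23} (λ _ → 1ℤ) (λ l → d l + v l) ⟩
        + 23 + ∑[ l < 23 ] (d l + v l)
          ≡⟨ cong (_+_ (+ 23)) (∑-distrib-+ d v) ⟩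
        + 23 + (sum d + sum v)
          ≡⟨ cong (λ s → + 23 + (sum d + s)) (trans (orthogonal i j) (cong (+ 16 *_) (I-offDiagonal i≢j))) ⟩
        + 23 + (sum d + 0ℤ)
          ≡⟨ cong (_+_ (+ 23)) (ℤ.+-identityʳ (sum d)) ⟩
        + 23 + sum d
          ≡⟨ ℤ.+-comm (+ 23) (sum d) ⟩
        sum d + + 23
          ∎)

    -- Pointwise form of the degree bound. The 4 = 7 - 3 gives equality on the diagonal, so that all
    -- 23 values of `j` can be summed at once.
    3+4I≤M+2adj : ∀ i j → + 3 + + 4 * I i j ≤ M i j + + 2 * 𝟙 (does (adj? i j))
    3+4I≤M+2adj i j with i ≟ j
    ... | yes refl = subst (λ m → + 7 ≤ m + + 0) (sym (M-diagonal i)) ≤-refl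
    ... | no i≢j   = 3≤odd+2[odd≡1] _ (2∣M+9 i≢j)

  12≤degree : ∀ i → + 12 ≤ degree (Γ W) i
  -- The left sides add up to 23 · 3 + 4 = 73 = 49 + 24; the 49 cancels against `∑M≡49`, leaving 24
  -- ≤ 2 · degree.
  12≤degree i = ℤ.*-cancelˡ-≤-pos (+ 12) _ (+ 2) (+-cancelˡ-≤ (+ 49) (begin
    + 49 + + 24
      ≡⟨ cong (_+_ (+ 69)) (sum-I {23} (λ _ → + 4) i) ⟨
    + 69 + ∑[ j < 23 ] (+ 4 * I i j)
      ≡⟨ ∑-distrib-+ {23} (λ _ → + 3) (λ j → + 4 * I i j) ⟨
    ∑[ j < 23 ] (+ 3 + + 4 * I i j)
      ≤⟨ sum-mono-≤ (3+4I≤M+2adj i) ⟩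
    ∑[ j < 23 ] (M i j + + 2 * a j)
      ≡⟨ ∑-distrib-+ (M i) (λ j → + 2 * a j) ⟩
    ∑[ j < 23 ] M i j + ∑[ j < 23 ] (+ 2 * a j)
      ≡⟨ cong₂ _+_ (∑M≡49 i) (sym (*-distribˡ-sum (+ 2) a)) ⟩
    + 49 + + 2 * degree (Γ W) i
      ∎))
    where
    open ℤ.≤-Reasoning
    a : Fin 23 → ℤ
    a j = 𝟙 (does (adj? i j))

proposition2 : (W : Matrix 23) → IsWeighing 16 W → edgeCount (Γ W) ≥ 138
proposition2 W isWeighing = ℤ.drop‿+≤+ (ℤ.*-cancelˡ-≤-pos (+ 138) _ (+ 2) (begin
  -- The constant sum evaluates to 276 = 2 · 138.
  ∑[ i < 23 ] (+ 12)            ≤⟨ sum-mono-≤ (12≤degree W isWeighing) ⟩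
  ∑[ i < 23 ] degree (Γ W) i    ≡⟨ handshake (Γ W) ⟩
  + 2 * + edgeCount (Γ W)       ∎))
  where open ℤ.≤-Reasoning
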